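{- Let $G$ be a simple regular graph on $n$ vertices with adjacency matrix $M$, and let $f$ be a perfect coloring of $G$ with parameter matrix $S$. Then for all $l\in\mathbb N$ (positive integers) and all vertices $u,v\in V(G)$, $$d([M^l]^u,[M^l]^v)\ \ge\ d([S^l]^{f(u)},[S^l]^{f(v)}).$$
   Context: A simple graph is undirected, without loops or multiple edges; its adjacency matrix $M$ is a symmetric $(0,1)$-matrix with zero diagonal. A perfect coloring of $G$ with parameter matrix $S=(s_{i,j})$ of order $k$ is a map $f:V(G)\to\{1,\dots,k\}$ such that every vertex $u$ with $f(u)=i$ has exactly $s_{i,j}$ neighbors of color $j$, for all colors $i,j$. $M^l$ and $S^l$ are ordinary matrix powers. $[A]^i$ denotes the $i$-th row of a square matrix $A$. For real tuples $x,y$ of the same length, $d(x,y)=\sum_i|x_i-y_i|$ is the $L_1$ distance. -}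

module Defs where

open import Data.Bool.Base using (if_then_else_)
open import Data.Fin.Base using (Fin)
open import Data.Fin.Properties using (_≟_)
open import Data.List.Base using (List; allFin; filter; length)
open import Data.Nat.Base using (ℕ; zero; suc; _*_; ∣_-_∣)
open import Data.Nat.Properties using (+-*-semiring)
open import Data.Product.Base using (∃-syntax)
open import Data.Vec.Functional using (Vector)
open import Level using (0ℓ)
open import Relation.Binary.Core using (Rel)
open import Relation.Binary.Definitions using (Decidable; Irreflexive; Symmetric)
open import Relation.Binary.PropositionalEquality.Core using (_≡_)
open import Relation.Nullary.Decidable.Core using (does)

open import Algebra.Properties.Semiring.Sum +-*-semiring using (sum)

-- All matrices here count neighbours or walks, so entries are natural numbers.
Matrix : ℕ → Set
Matrix n = Fin n → Fin n → ℕ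

infixl 7 _⊗_
infixr 8 _^ᴹ_

_⊗_ : ∀ {n} → Matrix n → Matrix n → Matrix n
(A ⊗ B) i j = sum (λ m → A i m * B m j)

identity : ∀ {n} → Matrix n
identity i j = if does (i ≟ j) then 1 else 0

_^ᴹ_ : ∀ {n} → Matrix n → ℕ → Matrix n
A ^ᴹ zero  = identity
A ^ᴹ suc l = A ⊗ (A ^ᴹ l)

row : ∀ {n} → Matrix n → Fin n → Vector ℕ n
row A i = A i

-- L₁ distance; ∣_-_∣ is the absolute difference, not truncated subtraction.
d : ∀ {n} → Vector ℕ n → Vector ℕ n → ℕ
d x y = sum (λ i → ∣ x i - y i ∣)

record SimpleGraph (n : ℕ) : Set₁ where
  infix 4 _~_ _~?_
  field
    _~_    : Rel (Fin n) 0ℓ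
    _~?_   : Decidable _~_
    ~-sym  : Symmetric _~_
    ~-irr  : Irreflexive _≡_ _~_

  neighbours : Fin n → List (Fin n)
  neighbours u = filter (u ~?_) (allFin n)

  degree : Fin n → ℕ
  degree u = length (neighbours u)

  Regular : Set
  Regular = ∃[ r ] (∀ u → degree u ≡ r)

  adjacencyMatrix : Matrix n
  adjacencyMatrix u v = if does (u ~? v) then 1 else 0

  -- f need not be surjective: rows of S at unused colours are unconstrained.
  IsPerfectColoring : ∀ {k} → (Fin n → Fin k) → Matrix k → Set
  IsPerfectColoring f S =
    ∀ u j → length (filter (λ v → f v ≟ j) (neighbours u)) ≡ S (f u) j

{-# OPTIONS --safe #-}
-- Let P be the vertex–colour incidence matrix, i.e. row v of P is row f(v) of
-- the identity.  A perfect coloring satisfies M P = P S, hence Mˡ P = P Sˡ, so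
-- row f(u) of Sˡ is row u of Mˡ multiplied by P.  As P is nonnegative with row
-- sums 1, right multiplication by P does not increase L₁ distances.
module Submission where

open import Defs
open import Data.Bool.Base using (true; false; if_then_else_)
open import Data.Fin.Base using (Fin; zero; suc)
open import Data.Fin.Properties using (_≟_)
open import Data.List.Base using (filter; length; tabulate)
open import Data.Nat.Base using (ℕ; zero; suc; _+_; _*_; ∣_-_∣; _≤_; z≤n; NonZero; _≥_)
open import Data.Nat.Properties hiding (_≟_)
open import Data.Vec.Functional using (Vector)
open import Function.Base using (_∘_; id)
open import Relation.Binary.PropositionalEquality
open import Relation.Nullary.Decidable.Core using (does)
open import Relation.Unary using (Pred; Decidable)

open import Algebra.Properties.Semiring.Sum +-*-semiring
  using (sum; sum-cong-≗; sum-replicate-zero; ∑-comm; *-distribˡ-sum; *-distribʳ-sum)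

sum-mono-≤ : ∀ {n} {x y : Vector ℕ n} → (∀ i → x i ≤ y i) → sum x ≤ sum y
sum-mono-≤ {zero}  x≤y = z≤n
sum-mono-≤ {suc n} x≤y = +-mono-≤ (x≤y zero) (sum-mono-≤ (x≤y ∘ suc))

-- Triangle inequality through `c + b`, which shares one summand with each endpoint.
∣+-+∣≤∣-∣+∣-∣ : ∀ a b c e → ∣ a + b - c + e ∣ ≤ ∣ a - c ∣ + ∣ b - e ∣
∣+-+∣≤∣-∣+∣-∣ a b c e = begin
  ∣ a + b - c + e ∣                      ≤⟨ ∣-∣-triangle (a + b) (c + b) (c + e) ⟩
  ∣ a + b - c + b ∣ + ∣ c + b - c + e ∣  ≡⟨ cong₂ _+_ cancelʳ (∣m+n-m+o∣≡∣n-o∣ c b e) ⟩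
  ∣ a - c ∣ + ∣ b - e ∣                  ∎
  where
  open ≤-Reasoning
  cancelʳ : ∣ a + b - c + b ∣ ≡ ∣ a - c ∣
  cancelʳ = trans (cong₂ ∣_-_∣ (+-comm a b) (+-comm c b)) (∣m+n-m+o∣≡∣n-o∣ b a c)

∣sum-sum∣≤d : ∀ {n} (x y : Vector ℕ n) → ∣ sum x - sum y ∣ ≤ d x y
∣sum-sum∣≤d {zero}  x y = z≤n
∣sum-sum∣≤d {suc n} x y =
  ≤-trans (∣+-+∣≤∣-∣+∣-∣ (x zero) _ (y zero) _)
          (+-monoʳ-≤ ∣ x zero - y zero ∣ (∣sum-sum∣≤d (x ∘ suc) (y ∘ suc)))

d-cong : ∀ {n} {x x′ y y′ : Vector ℕ n} → x ≗ x′ → y ≗ y′ → d x y ≡ d x′ y′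
d-cong x≗x′ y≗y′ = sum-cong-≗ λ i → cong₂ ∣_-_∣ (x≗x′ i) (y≗y′ i)

-- The triangle inequality is applied in each column `j`; after exchanging the sums, each
-- `∣ x w - y w ∣` is weighted by the total of row `w` of `P`, which is 1.
d-stochastic-≤ : ∀ {n k} (P : Fin n → Vector ℕ k) → (∀ w → sum (P w) ≡ 1) → (x y : Vector ℕ n) →
  d (λ j → sum λ w → x w * P w j) (λ j → sum λ w → y w * P w j) ≤ d x y
d-stochastic-≤ P sum-P≡1 x y = begin
  sum (λ j → ∣ sum (λ w → x w * P w j) - sum (λ w → y w * P w j) ∣)
    ≤⟨ sum-mono-≤ (λ j → ∣sum-sum∣≤d (λ w → x w * P w j) (λ w → y w * P w j)) ⟩
  sum (λ j → sum λ w → ∣ x w * P w j - y w * P w j ∣)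
    ≡⟨ ∑-comm (λ j w → ∣ x w * P w j - y w * P w j ∣) ⟩
  sum (λ w → sum λ j → ∣ x w * P w j - y w * P w j ∣)
    ≡⟨ sum-cong-≗ (λ w → sum-cong-≗ λ j → *-distribʳ-∣-∣ (P w j) (x w) (y w)) ⟨
  sum (λ w → sum λ j → ∣ x w - y w ∣ * P w j)
    ≡⟨ sum-cong-≗ (λ w → *-distribˡ-sum ∣ x w - y w ∣ (P w)) ⟨
  sum (λ w → ∣ x w - y w ∣ * sum (P w))
    ≡⟨ sum-cong-≗ (λ w → trans (cong (∣ x w - y w ∣ *_) (sum-P≡1 w)) (*-identityʳ _)) ⟩
  d x y ∎
  where open ≤-Reasoning

sum-identity-* : ∀ {n} (i : Fin n) (x : Vector ℕ n) → sum (λ j → identity i j * x j) ≡ x i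
sum-identity-* {suc n} zero    x =
  trans (cong₂ _+_ (*-identityˡ (x zero)) (sum-replicate-zero n)) (+-identityʳ (x zero))
-- The head term is `0 * x zero`, and `does (suc i ≟ suc j)` reduces to `does (i ≟ j)`, so the sum
-- computes to the one over the tail.
sum-identity-* {suc n} (suc i) x = sum-identity-* i (x ∘ suc)

sum-identity : ∀ {n} (i : Fin n) → sum (identity i) ≡ 1
sum-identity i =
  trans (sum-cong-≗ λ j → sym (*-identityʳ (identity i j))) (sum-identity-* i (λ _ → 1))

-- Stated for raw sums, since _⊗_ multiplies square matrices only.
sum-*-assoc : ∀ {m n} (x : Vector ℕ m) (A : Fin m → Vector ℕ n) (y : Vector ℕ n) →
  sum (λ j → sum (λ i → x i * A i j) * y j) ≡ sum (λ i → x i * sum (λ j → A i j * y j))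
sum-*-assoc x A y = begin
  sum (λ j → sum (λ i → x i * A i j) * y j)
    ≡⟨ sum-cong-≗ (λ j → *-distribʳ-sum (y j) (λ i → x i * A i j)) ⟩
  sum (λ j → sum λ i → x i * A i j * y j)
    ≡⟨ ∑-comm (λ j i → x i * A i j * y j) ⟩
  sum (λ i → sum λ j → x i * A i j * y j)
    ≡⟨ sum-cong-≗ (λ i → sum-cong-≗ λ j → *-assoc (x i) (A i j) (y j)) ⟩
  sum (λ i → sum λ j → x i * (A i j * y j))
    ≡⟨ sum-cong-≗ (λ i → *-distribˡ-sum (x i) (λ j → A i j * y j)) ⟨
  sum (λ i → x i * sum (λ j → A i j * y j)) ∎
  where open ≡-Reasoning

-- Induction on `l`: M(MˡP) = M(PSˡ) = (MP)Sˡ = (PS)Sˡ. Row `u` of a product PA is written directly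
-- as row `f u` of A.
^ᴹ-intertwines : ∀ {n k} (M : Matrix n) (f : Fin n → Fin k) (S : Matrix k) →
  (∀ u j → sum (λ w → M u w * identity (f w) j) ≡ S (f u) j) →
  ∀ l u j → sum (λ w → (M ^ᴹ l) u w * identity (f w) j) ≡ (S ^ᴹ l) (f u) j
^ᴹ-intertwines M f S MP≡PS zero    u j = sum-identity-* u (λ w → identity (f w) j)
^ᴹ-intertwines M f S MP≡PS (suc l) u j = begin
  sum (λ w → (M ⊗ M ^ᴹ l) u w * identity (f w) j)
    ≡⟨ sum-*-assoc (M u) (M ^ᴹ l) (λ w → identity (f w) j) ⟩
  sum (λ w → M u w * sum (λ v → (M ^ᴹ l) w v * identity (f v) j))
    ≡⟨ sum-cong-≗ (λ w → cong (M u w *_) (^ᴹ-intertwines M f S MP≡PS l w j)) ⟩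
  sum (λ w → M u w * (S ^ᴹ l) (f w) j)
    -- Row `f w` of Sˡ is expanded back into row `w` of PSˡ, so that reassociating exposes the
    -- product MP.
    ≡⟨ sum-cong-≗ (λ w → cong (M u w *_) (sum-identity-* (f w) (λ i → (S ^ᴹ l) i j))) ⟨
  sum (λ w → M u w * sum (λ i → identity (f w) i * (S ^ᴹ l) i j))
    ≡⟨ sum-*-assoc (M u) (identity ∘ f) (λ i → (S ^ᴹ l) i j) ⟨
  sum (λ i → sum (λ w → M u w * identity (f w) i) * (S ^ᴹ l) i j)
    ≡⟨ sum-cong-≗ (λ i → cong (_* (S ^ᴹ l) i j) (MP≡PS u i)) ⟩
  (S ⊗ S ^ᴹ l) (f u) j ∎
  where open ≡-Reasoning

-- Turns the neighbour count in `IsPerfectColoring` into an entry of MP. A general `g` lets the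
-- induction pass to `g ∘ suc`; `allFin` is the case `id`.
length-filter-filter-tabulate : ∀ {a p q} {A : Set a} {P : Pred A p} {Q : Pred A q}
  (P? : Decidable P) (Q? : Decidable Q) {n} (g : Fin n → A) →
  length (filter Q? (filter P? (tabulate g))) ≡
  sum (λ i → (if does (P? (g i)) then 1 else 0) * (if does (Q? (g i)) then 1 else 0))
length-filter-filter-tabulate P? Q? {zero}  g = refl
length-filter-filter-tabulate P? Q? {suc n} g with does (P? (g zero))
-- The head product `0 * _` already reduces to 0, so `Q?` need not be decided here.
... | false = length-filter-filter-tabulate P? Q? (g ∘ suc)
... | true with does (Q? (g zero))
...   | false = length-filter-filter-tabulate P? Q? (g ∘ suc)
...   | true  = cong suc (length-filter-filter-tabulate P? Q? (g ∘ suc))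

theorem4 : ∀ {n k : ℕ} (G : SimpleGraph n) → SimpleGraph.Regular G →
    (f : Fin n → Fin k) (S : Matrix k) → SimpleGraph.IsPerfectColoring G f S →
    ∀ (l : ℕ) .{{_ : NonZero l}} (u v : Fin n) →
    let M = SimpleGraph.adjacencyMatrix G in
    d (row (M ^ᴹ l) u) (row (M ^ᴹ l) v) ≥ d (row (S ^ᴹ l) (f u)) (row (S ^ᴹ l) (f v))
theorem4 G _ f S perfect l u v = begin
  d (row (S ^ᴹ l) (f u)) (row (S ^ᴹ l) (f v))
    ≡⟨ d-cong (MˡP≡PSˡ u) (MˡP≡PSˡ v) ⟨
  d (λ j → sum λ w → (M ^ᴹ l) u w * identity (f w) j)
    (λ j → sum λ w → (M ^ᴹ l) v w * identity (f w) j)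
    ≤⟨ d-stochastic-≤ (identity ∘ f) (sum-identity ∘ f) (row (M ^ᴹ l) u) (row (M ^ᴹ l) v) ⟩
  d (row (M ^ᴹ l) u) (row (M ^ᴹ l) v) ∎
  where
  open ≤-Reasoning
  open SimpleGraph G using (_~?_) renaming (adjacencyMatrix to M)
  MˡP≡PSˡ = ^ᴹ-intertwines M f S
    -- This is MP = PS: the indicator of `f x ≟ j` is by definition `identity (f x) j`, the entry of
    -- P at `x` and `j`.
    (λ w j → trans (sym (length-filter-filter-tabulate (w ~?_) (λ x → f x ≟ j) id)) (perfect w j)) l
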